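{- Let $\mathcal{L}=\{l_1, l_2, \dots, l_s\}$ be a set of $s$ nonnegative integers with $l_1<l_2<\dots<l_s$, and let $K=\{k_1,k_2,\dots,k_r\}$ be a set of positive integers with $k_i > s-r+l_1$ for every $1\le i\le r$. Suppose that $\mathcal{A}=\{A_1,A_2,\dots,A_m\}$ is a family of (distinct) subsets of $[n]=\{1,2,\dots,n\}$ such that $|A_i|\in K$ for every $1\le i\le m$ and $|A_i\cap A_j|\in\mathcal{L}$ for every pair $i\neq j$. Let $k=\max\{|A_j| : 1\le j\le m\}$. If $n\ge \binom{k^2}{l_1+1}s+l_1$, then \[ m\le \binom{n-l_1}{s}+\binom{n-l_1}{s-1}+\cdots+\binom{n-l_1}{s-r+1}. \] Moreover, if $n>\binom{k^2}{l_1+1}s+l_1$, equality holds only if there exists an $l_1$-subset $T$ of $[n]$ such that $T\subseteq A_j$ for every $j$.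
   Context: $\binom{a}{b}$ denotes the usual binomial coefficient, with $\binom{a}{b}=0$ if $b<0$. -}

module Defs where

open import Data.Nat using (ℕ; zero; suc; _+_; _⊔_; _≤?_)
open import Data.Nat.Combinatorics using (_C_)
open import Data.Fin using (Fin; zero; suc)
open import Relation.Nullary using (yes; no)

maxF : ∀ {m} → (Fin m → ℕ) → ℕ
maxF {zero}  f = 0
maxF {suc m} f = f zero ⊔ maxF (λ i → f (suc i))

binomSub : ℕ → ℕ → ℕ → ℕ
binomSub N s j with j ≤? s
... | yes _ = N C (s Data.Nat.∸ j)
... | no  _ = 0

boundSum : ℕ → ℕ → ℕ → ℕ
boundSum N s zero    = 0
boundSum N s (suc r) = boundSum N s r + binomSub N s r

module Submission where

-- If all members share an l₁-set T, delete it and apply the Alon–Babai–Suzuki theorem on the remaining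
-- n ∸ l₁ points. That theorem is proved by the polynomial method. Take as points the members A together
-- with all sets I of size at most s - r. If the bound failed, they would outnumber the multilinear
-- monomials of degree at most s, so some nonzero weighting of the points would annihilate every polynomial
-- of degree at most s. But each point carries such a polynomial, nonzero there and zero at all other points
-- of no larger rank; a point of maximal rank in the support of the weighting gives a contradiction.
--
-- If there is no common l₁-set, some M with ∣M∣ ≤ k² meets every member in more than l₁ points. The family is
-- then a union of at most C(k², l₁+1) stars over (l₁+1)-sets; in a star only s - 1 intersection sizes survive,
-- so Alon–Babai–Suzuki with s - 1 in place of s bounds it, and n is large enough for the total to be smaller
-- than the claimed bound.

open import Defs
open import Data.Nat as ℕ using (ℕ; zero; suc; pred; s≤s; z≤n; _∸_; _≤_; _<_; _≟_; _≤?_; _<?_)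
import Data.Nat.Properties as ℕ
open import Data.Nat.Combinatorics using (_C_; nC1≡n; nCn≡1; nCk≡nC[n∸k]; k>n⇒nCk≡0; nCk+nC[k+1]≡[n+1]C[k+1])
import Data.Integer.Properties as ℤ
open import Algebra.Properties.Semiring.Sum ℤ.+-*-semiring
open import Data.Bool using (true; false; if_then_else_)
open import Data.Empty using () renaming (⊥ to Empty)
import Data.Fin as Fin
open import Data.Fin using (Fin; zero; suc; punchIn)
open import Data.Fin.Properties using (any?; toℕ<n; punchInᵢ≢i; injective⇒≤)
import Data.Fin.Subset as Subset
open import Data.Fin.Subset using (Subset; _∩_; _∪_; ∁; _⊆_; ∣_∣; ⊤; ⊥; ⁅_⁆; inside; outside)
open import Data.Fin.Subset.Properties
open import Data.List using (List; []; _∷_; _++_; map; length; lookup; filter; tabulate; allFin)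
open import Data.List.Extrema.Nat using (argmax; argmax-all; f[xs]≤f[argmax])
open import Data.List.Membership.Propositional using (_∈_; lose)
open import Data.List.Membership.Propositional.Properties
open import Data.List.Properties using (length-map; length-++; length-filter; length-tabulate; filter-all)
open import Data.List.Relation.Binary.Sublist.Propositional.Properties using (filter⁺; filter-⊆; length-mono-≤)
import Data.List.Relation.Unary.All as All
import Data.List.Relation.Unary.All.Properties as All
open import Data.List.Relation.Unary.AllPairs using ([]; _∷_)
open import Data.List.Relation.Unary.Any using (Any; here; there; index)
open import Data.List.Relation.Unary.Any.Properties using (lookup-index)
open import Data.List.Relation.Unary.Unique.Propositional using (Unique)
import Data.List.Relation.Unary.Unique.Propositional.Properties as Unique
open import Data.Product using (Σ; ∃; _×_; _,_; proj₁; proj₂)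
open import Data.Sum using (_⊎_; inj₁; inj₂; map₂)
open import Data.Sum.Properties using (inj₁-injective; inj₂-injective)
open import Data.Vec as Vec using ([]; _∷_)
open import Data.Vec.Functional using (insertAt)
open import Data.Vec.Functional.Properties using (insertAt-lookup; insertAt-punchIn)
open import Data.Vec.Properties using (∷-injectiveˡ; ∷-injectiveʳ; []=⇒lookup; lookup⇒[]=)
open import Function using (_∘_; case_of_)
open import Function.Definitions using (Injective)
open import Relation.Binary.PropositionalEquality
open import Relation.Nullary using (Dec; ¬_; ¬?; yes; no; does)
open import Relation.Nullary.Decidable using (decidable-stable)
open import Relation.Nullary.Negation using (contradiction)

-- Subsets of a given size

nC0≡1 : ∀ n → n C 0 ≡ 1
nC0≡1 n = trans (nCk≡nC[n∸k] {0} {n} z≤n) (nCn≡1 n)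

lookup-injective : ∀ {A : Set} {xs : List A} → Unique xs → ∀ {i j} → lookup xs i ≡ lookup xs j → i ≡ j
lookup-injective (_ ∷ _)     {zero}  {zero}  _  = refl
lookup-injective (x∉xs ∷ _)  {zero}  {suc j} eq = contradiction eq (All.lookup x∉xs (∈-lookup j))
lookup-injective (x∉xs ∷ _)  {suc i} {zero}  eq = contradiction (sym eq) (All.lookup x∉xs (∈-lookup i))
lookup-injective (_ ∷ uniq)  {suc i} {suc j} eq = cong suc (lookup-injective uniq eq)

choices : ∀ {n} → Subset n → ℕ → List (Subset n)
choices []            zero    = [] ∷ []
choices []            (suc i) = []
choices (outside ∷ M) i       = map (outside ∷_) (choices M i)
choices (inside ∷ M)  zero    = map (outside ∷_) (choices M zero)
choices (inside ∷ M)  (suc i) = map (inside ∷_) (choices M i) ++ map (outside ∷_) (choices M (suc i))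

length-choices : ∀ {n} (M : Subset n) i → length (choices M i) ≡ ∣ M ∣ C i
length-choices []            zero    = refl
length-choices []            (suc i) = sym (k>n⇒nCk≡0 {0} {suc i} (s≤s z≤n))
length-choices (outside ∷ M) i       = trans (length-map _ (choices M i)) (length-choices M i)
length-choices (inside ∷ M)  zero    = begin
  length (map (outside ∷_) (choices M zero)) ≡⟨ length-map _ (choices M zero) ⟩
  length (choices M zero)                    ≡⟨ length-choices M zero ⟩
  ∣ M ∣ C 0                                  ≡⟨ nC0≡1 ∣ M ∣ ⟩
  1                                          ≡⟨ nC0≡1 (suc ∣ M ∣) ⟨
  suc ∣ M ∣ C 0                              ∎
  where open ≡-Reasoning
length-choices (inside ∷ M)  (suc i) = begin
  length (map (inside ∷_) (choices M i) ++ map (outside ∷_) (choices M (suc i)))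
    ≡⟨ length-++ (map (inside ∷_) (choices M i)) ⟩
  length (map (inside ∷_) (choices M i)) ℕ.+ length (map (outside ∷_) (choices M (suc i)))
    ≡⟨ cong₂ ℕ._+_ (length-map _ (choices M i)) (length-map _ (choices M (suc i))) ⟩
  length (choices M i) ℕ.+ length (choices M (suc i))
    ≡⟨ cong₂ ℕ._+_ (length-choices M i) (length-choices M (suc i)) ⟩
  ∣ M ∣ C i ℕ.+ ∣ M ∣ C suc i
    ≡⟨ nCk+nC[k+1]≡[n+1]C[k+1] ∣ M ∣ i ⟩
  suc ∣ M ∣ C suc i ∎
  where open ≡-Reasoning

∈-choices⁺ : ∀ {n} {M S : Subset n} → S ⊆ M → S ∈ choices M ∣ S ∣
∈-choices⁺ {M = []}          {[]}          _   = here refl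
∈-choices⁺ {M = outside ∷ M} {outside ∷ S} S⊆M = ∈-map⁺ _ (∈-choices⁺ (drop-∷-⊆ S⊆M))
∈-choices⁺ {M = outside ∷ M} {inside ∷ S}  S⊆M with () ← S⊆M Vec.here
∈-choices⁺ {M = inside ∷ M}  {inside ∷ S}  S⊆M = ∈-++⁺ˡ (∈-map⁺ _ (∈-choices⁺ (drop-∷-⊆ S⊆M)))
∈-choices⁺ {M = inside ∷ M}  {outside ∷ S} S⊆M with ∣ S ∣ | ∈-choices⁺ (drop-∷-⊆ S⊆M)
... | zero  | S∈ = ∈-map⁺ _ S∈
... | suc i | S∈ = ∈-++⁺ʳ (map (inside ∷_) (choices M i)) (∈-map⁺ _ S∈)

∈-choices⁻ : ∀ {n} (M : Subset n) i {S} → S ∈ choices M i → ∣ S ∣ ≡ i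
∈-choices⁻ []            zero    (here refl) = refl
∈-choices⁻ (outside ∷ M) i       S∈ with _ , S′∈ , refl ← ∈-map⁻ _ S∈ = ∈-choices⁻ M i S′∈
∈-choices⁻ (inside ∷ M)  zero    S∈ with _ , S′∈ , refl ← ∈-map⁻ _ S∈ = ∈-choices⁻ M zero S′∈
∈-choices⁻ (inside ∷ M)  (suc i) S∈ with ∈-++⁻ (map (inside ∷_) (choices M i)) S∈
... | inj₁ S∈ˡ with _ , S′∈ , refl ← ∈-map⁻ _ S∈ˡ = cong suc (∈-choices⁻ M i S′∈)
... | inj₂ S∈ʳ with _ , S′∈ , refl ← ∈-map⁻ _ S∈ʳ = ∈-choices⁻ M (suc i) S′∈

choices-unique : ∀ {n} (M : Subset n) i → Unique (choices M i)
choices-unique []            zero    = All.[] ∷ []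
choices-unique []            (suc i) = []
choices-unique (outside ∷ M) i       = Unique.map⁺ ∷-injectiveʳ (choices-unique M i)
choices-unique (inside ∷ M)  zero    = Unique.map⁺ ∷-injectiveʳ (choices-unique M zero)
choices-unique (inside ∷ M)  (suc i) =
  Unique.++⁺ (Unique.map⁺ ∷-injectiveʳ (choices-unique M i)) (Unique.map⁺ ∷-injectiveʳ (choices-unique M (suc i)))
    λ (S∈ˡ , S∈ʳ) → inside≢outside (∈-map⁻ _ S∈ˡ) (∈-map⁻ _ S∈ʳ)
  where
  inside≢outside : ∀ {n S} {Ss Ts : List (Subset n)} →
    (∃ λ T → T ∈ Ss × S ≡ inside ∷ T) → (∃ λ T → T ∈ Ts × S ≡ outside ∷ T) → Empty
  inside≢outside (_ , _ , refl) (_ , _ , ())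

-- With a strict size bound, `smaller n (suc s ∸ r)` lists the sets of size at most s - r when r ≤ s
-- and is empty when r > s.
smaller : ∀ n → ℕ → List (Subset n)
smaller n zero    = []
smaller n (suc t) = choices ⊤ t ++ smaller n t

∈-smaller⁺ : ∀ {n t} {S : Subset n} → ∣ S ∣ < t → S ∈ smaller n t
∈-smaller⁺ {n} {suc t} {S} (s≤s ∣S∣≤t) with ℕ.m≤n⇒m<n∨m≡n ∣S∣≤t
... | inj₁ ∣S∣<t = ∈-++⁺ʳ (choices ⊤ t) (∈-smaller⁺ ∣S∣<t)
... | inj₂ refl  = ∈-++⁺ˡ (∈-choices⁺ {S = S} ⊆⊤)

∈-smaller⁻ : ∀ {n} t {S : Subset n} → S ∈ smaller n t → ∣ S ∣ < t
∈-smaller⁻ (suc t) S∈ with ∈-++⁻ (choices ⊤ t) S∈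
... | inj₁ S∈ˡ = s≤s (ℕ.≤-reflexive (∈-choices⁻ ⊤ t S∈ˡ))
... | inj₂ S∈ʳ = ℕ.m<n⇒m<1+n (∈-smaller⁻ t S∈ʳ)

smaller-unique : ∀ n t → Unique (smaller n t)
smaller-unique n zero    = []
smaller-unique n (suc t) = Unique.++⁺ (choices-unique ⊤ t) (smaller-unique n t)
  λ (S∈ˡ , S∈ʳ) → ℕ.<⇒≢ (∈-smaller⁻ t S∈ʳ) (∈-choices⁻ ⊤ t S∈ˡ)

length-smaller-suc : ∀ n t → length (smaller n (suc t)) ≡ n C t ℕ.+ length (smaller n t)
length-smaller-suc n t = begin
  length (choices {n} ⊤ t ++ smaller n t)            ≡⟨ length-++ (choices {n} ⊤ t) ⟩
  length (choices {n} ⊤ t) ℕ.+ length (smaller n t)  ≡⟨ cong (ℕ._+ length (smaller n t)) (length-choices {n} ⊤ t) ⟩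
  ∣ ⊤ {n} ∣ C t ℕ.+ length (smaller n t)             ≡⟨ cong (λ k → k C t ℕ.+ length (smaller n t)) (∣⊤∣≡n n) ⟩
  n C t ℕ.+ length (smaller n t)                     ∎
  where open ≡-Reasoning

-- Telescoping: `binomSub n s r` counts the sets of size s - r, the top layer of
-- `smaller n (suc s ∸ r)`; once r > s no layer is left and the term is 0.
boundSum+length-smaller : ∀ n s r → boundSum n s r ℕ.+ length (smaller n (suc s ∸ r)) ≡ length (smaller n (suc s))
boundSum+length-smaller n s zero    = refl
boundSum+length-smaller n s (suc r) = trans (ℕ.+-assoc (boundSum n s r) _ _)
  (trans (cong (boundSum n s r ℕ.+_) step) (boundSum+length-smaller n s r))
  where
  step : binomSub n s r ℕ.+ length (smaller n (s ∸ r)) ≡ length (smaller n (suc s ∸ r))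
  step with r ℕ.≤? s
  ... | yes r≤s rewrite ℕ.+-∸-assoc 1 r≤s = sym (length-smaller-suc n (s ∸ r))
  ... | no  r≰s rewrite ℕ.m≤n⇒m∸n≡0 (ℕ.<⇒≤ (ℕ.≰⇒> r≰s)) | ℕ.m≤n⇒m∸n≡0 (ℕ.≰⇒> r≰s) = refl

module _ where
  open import Data.Integer as ℤ using (ℤ; 0ℤ; 1ℤ; +_; _+_; _*_; -_; _-_)
  open import Data.Integer.Tactic.RingSolver using (solve-∀)

  -- Linear dependence over ℤ

  sum-zero : ∀ {n} {f : Fin n → ℤ} → (∀ i → f i ≡ 0ℤ) → sum f ≡ 0ℤ
  sum-zero {n} f≡0 = trans (sum-cong-≗ f≡0) (sum-replicate-zero n)

  Dependency : ∀ {N D} → (Fin N → Fin D → ℤ) → (Fin N → ℤ) → Set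
  Dependency V c = (∃ λ a → c a ≢ 0ℤ) × (∀ d → sum (λ a → c a * V a d) ≡ 0ℤ)

  -- Fraction-free elimination of the column o with pivot row a₀.
  module Elimination {N D} (V : Fin (suc N) → Fin D → ℤ) (o : Fin D) (a₀ : Fin (suc N)) (c : Fin N → ℤ) where
    row : Fin N → Fin D → ℤ
    row j = V (punchIn a₀ j)

    lift : Fin (suc N) → ℤ
    lift = insertAt (λ j → V a₀ o * c j) a₀ (- sum (λ j → c j * row j o))

    reduced : Fin N → Fin D → ℤ
    reduced j d = V a₀ o * row j d - row j o * V a₀ d

    -- The coefficient of the pivot row gathers the multiples of that row subtracted in `reduced`,
    -- so a relation among reduced rows pulls back to the rows of `V`.
    sum-lift : ∀ d → sum (λ a → lift a * V a d) ≡ sum (λ j → c j * reduced j d)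
    sum-lift d = begin
      sum (λ a → lift a * V a d)
        ≡⟨ sum-remove {i = a₀} (λ a → lift a * V a d) ⟩
      lift a₀ * V a₀ d + sum (λ j → lift (punchIn a₀ j) * row j d)
        ≡⟨ cong₂ _+_ (cong (_* V a₀ d) (insertAt-lookup _ a₀ _))
             (sum-cong-≗ λ j → cong (_* row j d) (insertAt-punchIn _ a₀ _ j)) ⟩
      - sum (λ j → c j * row j o) * V a₀ d + sum (λ j → V a₀ o * c j * row j d)
        ≡⟨ cong (_+ sum (λ j → V a₀ o * c j * row j d)) (trans (neg-swap (sum pivoted) (V a₀ d)) (*-distribʳ-sum (- V a₀ d) pivoted)) ⟩
      sum (λ j → c j * row j o * - V a₀ d) + sum (λ j → V a₀ o * c j * row j d)
        ≡⟨ ∑-distrib-+ (λ j → pivoted j * - V a₀ d) (λ j → V a₀ o * c j * row j d) ⟨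
      sum (λ j → c j * row j o * - V a₀ d + V a₀ o * c j * row j d)
        ≡⟨ sum-cong-≗ (λ j → rearrange (c j) (row j o) (V a₀ d) (V a₀ o) (row j d)) ⟩
      sum (λ j → c j * reduced j d) ∎
      where
      open ≡-Reasoning
      pivoted : Fin N → ℤ
      pivoted j = c j * row j o
      neg-swap : ∀ x y → - x * y ≡ x * - y
      neg-swap = solve-∀
      rearrange : ∀ c x y p z → c * x * - y + p * c * z ≡ c * (p * z - x * y)
      rearrange = solve-∀

  -- Induction on the number of columns. A zero column is dropped; otherwise a pivot removes one row
  -- and one column. Lifting multiplies the remaining coefficients by the pivot, so a nonzero one
  -- stays nonzero in ℤ.
  dependent : ∀ {N D} → D ℕ.< N → (V : Fin N → Fin D → ℤ) → ∃ (Dependency V)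
  dependent {suc N} {zero} _ V = (λ _ → 1ℤ) , (zero , λ ()) , λ ()
  dependent {suc N} {suc D} (s≤s D<N) V with any? (λ a → ¬? (V a zero ℤ.≟ 0ℤ))
  ... | no all-zero with dependent (ℕ.m<n⇒m<1+n D<N) (λ a d → V a (suc d))
  ...   | c , c≢0 , eqs = c , c≢0 , λ where
          zero    → sum-zero λ a → trans (cong (c a *_)
                      (decidable-stable (V a zero ℤ.≟ 0ℤ) λ V≢0 → all-zero (a , V≢0))) (ℤ.*-zeroʳ (c a))
          (suc d) → eqs d
  dependent {suc N} {suc D} (s≤s D<N) V | yes (a₀ , p≢0)
    -- These are the rows of `reduced`, spelled out because `Elimination` takes as a parameter the
    -- coefficients `c` that this call returns.
    with dependent D<N (λ j d → V a₀ zero * V (punchIn a₀ j) (suc d) - V (punchIn a₀ j) zero * V a₀ (suc d))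
  ... | c , (j , c≢0) , eqs = lift , (punchIn a₀ j , lift≢0) , λ where
          zero    → trans (sum-lift zero) (sum-zero λ j → cancel (c j) (V a₀ zero) (row j zero))
          (suc d) → trans (sum-lift (suc d)) (eqs d)
    where
    open Elimination V zero a₀ c
    cancel : ∀ c p x → c * (p * x - x * p) ≡ 0ℤ
    cancel = solve-∀
    lift≢0 : lift (punchIn a₀ j) ≢ 0ℤ
    lift≢0 eq with ℤ.i*j≡0⇒i≡0∨j≡0 (V a₀ zero) (trans (sym (insertAt-punchIn _ a₀ _ j)) eq)
    ... | inj₁ p≡0 = p≢0 p≡0
    ... | inj₂ c≡0 = c≢0 c≡0

  sum-single : ∀ {n} {f : Fin n → ℤ} i → (∀ j → j ≢ i → f j ≡ 0ℤ) → sum f ≡ f i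
  sum-single {suc n} {f} i f≡0 = begin
    sum f                                 ≡⟨ sum-remove {i = i} f ⟩
    f i + sum (λ j → f (punchIn i j))     ≡⟨ cong (λ x → f i + x) (sum-zero λ j → f≡0 (punchIn i j) (punchInᵢ≢i i j)) ⟩
    f i + 0ℤ                              ≡⟨ ℤ.+-identityʳ (f i) ⟩
    f i                                   ∎
    where open ≡-Reasoning

  -- Multilinear polynomials on the cube

  maximiser : ∀ {N} {P : Fin N → Set} (P? : ∀ a → Dec (P a)) (ρ : Fin N → ℕ) →
              ∃ P → ∃ λ a → P a × (∀ b → P b → ρ b ≤ ρ a)
  maximiser P? ρ (a₀ , Pa₀) =
    argmax ρ a₀ candidates ,
    argmax-all ρ Pa₀ (All.all-filter P? (allFin _)) ,
    λ b Pb → All.lookup (f[xs]≤f[argmax] {f = ρ} a₀ candidates) (∈-filter⁺ P? (∈-allFin b) Pb)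
    where candidates = filter P? (allFin _)

  monomial : ∀ {n} → Subset n → Subset n → ℤ
  monomial S p = if does (S ⊆? p) then 1ℤ else 0ℤ

  coordinate : ∀ {n} → Subset n → Fin n → ℤ
  coordinate p i = if Vec.lookup p i then 1ℤ else 0ℤ

  monomial-⊆ : ∀ {n} {S p : Subset n} → S ⊆ p → monomial S p ≡ 1ℤ
  monomial-⊆ {S = S} {p} S⊆p with S ⊆? p
  ... | yes _ = refl
  ... | no S⊈p = contradiction (λ {x} → S⊆p {x}) S⊈p

  monomial-⊈ : ∀ {n} {S p : Subset n} → ¬ (S ⊆ p) → monomial S p ≡ 0ℤ
  monomial-⊈ {S = S} {p} S⊈p with S ⊆? p
  ... | yes S⊆p = contradiction (λ {x} → S⊆p {x}) S⊈p
  ... | no _ = refl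

  -- For i already in S this is x_i² = x_i, true because coordinates are 0 or 1; it keeps products
  -- multilinear.
  monomial-insert : ∀ {n} (S p : Subset n) i → monomial (S ∪ ⁅ i ⁆) p ≡ monomial S p * coordinate p i
  monomial-insert S p i with Vec.lookup p i in eq
  ... | false = trans (monomial-⊈ S∪i⊈p) (sym (ℤ.*-zeroʳ (monomial S p)))
    where
    S∪i⊈p : ¬ (S ∪ ⁅ i ⁆ ⊆ p)
    S∪i⊈p S∪i⊆p with () ← trans (sym eq) ([]=⇒lookup (S∪i⊆p (x∈p∪q⁺ (inj₂ (x∈⁅x⁆ i)))))
  ... | true = trans unchanged (sym (ℤ.*-identityʳ (monomial S p)))
    where
    i∈p : i Subset.∈ p
    i∈p = lookup⇒[]= i p eq
    unchanged : monomial (S ∪ ⁅ i ⁆) p ≡ monomial S p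
    unchanged with S ⊆? p
    ... | no S⊈p = monomial-⊈ λ S∪i⊆p → S⊈p (λ x∈S → S∪i⊆p (p⊆p∪q ⁅ i ⁆ x∈S))
    ... | yes S⊆p = monomial-⊆ λ x∈ → case x∈p∪q⁻ S ⁅ i ⁆ x∈ of λ where
      (inj₁ x∈S) → S⊆p x∈S
      (inj₂ x∈i) → subst (Subset._∈ p) (sym (x∈⁅y⁆⇒x≡y i x∈i)) i∈p

  ∣S∪i∣≤1+∣S∣ : ∀ {n} (S : Subset n) i → ∣ S ∪ ⁅ i ⁆ ∣ ≤ suc ∣ S ∣
  ∣S∪i∣≤1+∣S∣ (outside ∷ S) zero = s≤s (ℕ.≤-reflexive (cong ∣_∣ (∪-identityʳ S)))
  ∣S∪i∣≤1+∣S∣ (inside ∷ S)  zero = s≤s (ℕ.≤-trans (ℕ.≤-reflexive (cong ∣_∣ (∪-identityʳ S))) (ℕ.n≤1+n _))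
  ∣S∪i∣≤1+∣S∣ (outside ∷ S) (suc i) = ∣S∪i∣≤1+∣S∣ S i
  ∣S∪i∣≤1+∣S∣ (inside ∷ S)  (suc i) = s≤s (∣S∪i∣≤1+∣S∣ S i)

  ∣∩∣-as-sum : ∀ {n} (B p : Subset n) → + ∣ B ∩ p ∣ ≡ sum (λ i → coordinate B i * coordinate p i)
  ∣∩∣-as-sum []            []            = refl
  ∣∩∣-as-sum (outside ∷ B) (_ ∷ p)       = trans (∣∩∣-as-sum B p) (sym (ℤ.+-identityˡ _))
  ∣∩∣-as-sum (inside ∷ B)  (outside ∷ p) = trans (∣∩∣-as-sum B p) (sym (ℤ.+-identityˡ _))
  ∣∩∣-as-sum (inside ∷ B)  (inside ∷ p)  = cong (λ x → 1ℤ + x) (∣∩∣-as-sum B p)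

  -- The polynomial ∏ (∣ B ∩ x ∣ - l) over l in `ls`, evaluated at p. It is never expanded in full;
  -- the length of `ls` stands for its degree.
  levels : ∀ {n} → Subset n → List ℕ → Subset n → ℤ
  levels B []       p = 1ℤ
  levels B (l ∷ ls) p = (+ ∣ B ∩ p ∣ - + l) * levels B ls p

  levels-∈ : ∀ {n} (B : Subset n) {ls p} → ∣ B ∩ p ∣ ∈ ls → levels B ls p ≡ 0ℤ
  levels-∈ B {l ∷ ls} {p} (here refl)       = cong (_* levels B ls p) (ℤ.+-inverseʳ (+ l))
  levels-∈ B {l ∷ _} {p} (there ∣B∩p∣∈) =
    trans (cong ((+ ∣ B ∩ p ∣ - + l) *_) (levels-∈ B ∣B∩p∣∈)) (ℤ.*-zeroʳ (+ ∣ B ∩ p ∣ - + l))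

  levels-≢0 : ∀ {n} (B : Subset n) ls {p} → (∀ {l} → l ∈ ls → ∣ B ∩ p ∣ ≢ l) → levels B ls p ≢ 0ℤ
  levels-≢0 B (l ∷ ls) {p} avoid eq with ℤ.i*j≡0⇒i≡0∨j≡0 (+ ∣ B ∩ p ∣ - + l) eq
  ... | inj₁ eq₁ = avoid (here refl) (ℤ.+-injective (ℤ.i-j≡0⇒i≡j (+ ∣ B ∩ p ∣) (+ l) eq₁))
  ... | inj₂ eq₂ = levels-≢0 B ls (avoid ∘ there) eq₂

  -- ∣ B ∩ x ∣ is the sum of the variables x_i over i ∈ B, and x_S x_i = x_(S ∪ i) on the cube, so each linear
  -- factor raises the degree by at most one.
  annihilates : ∀ {n N s} (c : Fin N → ℤ) (p : Fin N → Subset n) →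
    (∀ S → ∣ S ∣ ≤ s → sum (λ a → c a * monomial S (p a)) ≡ 0ℤ) →
    ∀ B ls S → length ls ℕ.+ ∣ S ∣ ≤ s → sum (λ a → c a * (monomial S (p a) * levels B ls (p a))) ≡ 0ℤ
  annihilates c p kills B [] S ∣S∣≤s =
    trans (sum-cong-≗ λ a → cong (c a *_) (ℤ.*-identityʳ (monomial S (p a)))) (kills S ∣S∣≤s)
  annihilates {n} {N} {s} c p kills B (l ∷ ls) S deg≤s = begin
    sum (λ a → c a * (m a * ((+ ∣ B ∩ p a ∣ - + l) * q a)))
      ≡⟨ sum-cong-≗ expand ⟩
    sum (λ a → sum (λ i → coordinate B i * (c a * (monomial (S ∪ ⁅ i ⁆) (p a) * q a))) + - + l * (c a * (m a * q a)))
      ≡⟨ ∑-distrib-+ (λ a → sum (term a)) (λ a → - + l * (c a * (m a * q a))) ⟩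
    sum (λ a → sum (term a)) + sum (λ a → - + l * (c a * (m a * q a)))
      ≡⟨ cong₂ _+_ (∑-comm term) (sym (*-distribˡ-sum (- + l) (λ a → c a * (m a * q a)))) ⟩
    sum (λ i → sum (λ a → term a i)) + - + l * sum (λ a → c a * (m a * q a))
      ≡⟨ cong₂ _+_ (sum-zero column) (cong (- + l *_) (annihilates c p kills B ls S (ℕ.≤-trans (ℕ.n≤1+n _) deg≤s))) ⟩
    0ℤ + - + l * 0ℤ
      ≡⟨ trans (ℤ.+-identityˡ _) (ℤ.*-zeroʳ (- + l)) ⟩
    0ℤ ∎
    where
    open ≡-Reasoning
    m q : Fin N → ℤ
    m a = monomial S (p a)
    q a = levels B ls (p a)
    term : Fin N → Fin n → ℤ
    term a i = coordinate B i * (c a * (monomial (S ∪ ⁅ i ⁆) (p a) * q a))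
    -- Dropping the root `l` pays for the element i added to S, so the degree budget s is respected.
    column : ∀ i → sum (λ a → term a i) ≡ 0ℤ
    column i = begin
      sum (λ a → term a i)
        ≡⟨ *-distribˡ-sum (coordinate B i) (λ a → c a * (monomial (S ∪ ⁅ i ⁆) (p a) * q a)) ⟨
      coordinate B i * sum (λ a → c a * (monomial (S ∪ ⁅ i ⁆) (p a) * q a))
        ≡⟨ cong (coordinate B i *_) (annihilates c p kills B ls (S ∪ ⁅ i ⁆)
             (ℕ.≤-trans (ℕ.+-monoʳ-≤ (length ls) (∣S∪i∣≤1+∣S∣ S i))
               (ℕ.≤-trans (ℕ.≤-reflexive (ℕ.+-suc (length ls) ∣ S ∣)) deg≤s))) ⟩
      coordinate B i * 0ℤ
        ≡⟨ ℤ.*-zeroʳ (coordinate B i) ⟩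
      0ℤ ∎
    split : ∀ c m k l q → c * (m * ((k - l) * q)) ≡ c * (m * q) * k + - l * (c * (m * q))
    split = solve-∀
    regroup : ∀ c m q b x → c * (m * q) * (b * x) ≡ b * (c * (m * x * q))
    regroup = solve-∀
    expand : ∀ a → c a * (m a * ((+ ∣ B ∩ p a ∣ - + l) * q a)) ≡ sum (term a) + - + l * (c a * (m a * q a))
    expand a = trans (split (c a) (m a) (+ ∣ B ∩ p a ∣) (+ l) (q a)) (cong (_+ - + l * (c a * (m a * q a))) (begin
      c a * (m a * q a) * + ∣ B ∩ p a ∣
        ≡⟨ cong (c a * (m a * q a) *_) (∣∩∣-as-sum B (p a)) ⟩
      c a * (m a * q a) * sum (λ i → coordinate B i * coordinate (p a) i)
        ≡⟨ *-distribˡ-sum (c a * (m a * q a)) (λ i → coordinate B i * coordinate (p a) i) ⟩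
      sum (λ i → c a * (m a * q a) * (coordinate B i * coordinate (p a) i))
        ≡⟨ sum-cong-≗ (λ i → trans (regroup (c a) (m a) (q a) (coordinate B i) (coordinate (p a) i))
             (cong (λ x → coordinate B i * (c a * (x * q a))) (sym (monomial-insert S (p a) i)))) ⟩
      sum (term a) ∎))

  ⊆∧∣∣≥⇒≡ : ∀ {n} {A B : Subset n} → A ⊆ B → ∣ B ∣ ≤ ∣ A ∣ → A ≡ B
  ⊆∧∣∣≥⇒≡ {A = []} {[]} _ _ = refl
  ⊆∧∣∣≥⇒≡ {A = outside ∷ A} {outside ∷ B} A⊆B ∣B∣≤ = cong (outside ∷_) (⊆∧∣∣≥⇒≡ (drop-∷-⊆ A⊆B) ∣B∣≤)
  ⊆∧∣∣≥⇒≡ {A = inside ∷ A} {inside ∷ B} A⊆B (s≤s ∣B∣≤) = cong (inside ∷_) (⊆∧∣∣≥⇒≡ (drop-∷-⊆ A⊆B) ∣B∣≤)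
  ⊆∧∣∣≥⇒≡ {A = inside ∷ A} {outside ∷ B} A⊆B _ with () ← A⊆B Vec.here
  ⊆∧∣∣≥⇒≡ {A = outside ∷ A} {inside ∷ B} A⊆B ∣B∣≤ =
    contradiction (ℕ.<-≤-trans ∣B∣≤ (p⊆q⇒∣p∣≤∣q∣ (drop-∷-⊆ A⊆B))) (ℕ.<-irrefl refl)

  -- The Alon–Babai–Suzuki bound

  module AlonBabaiSuzuki {n} (L K : List ℕ) (As : List (Subset n)) (uniq : Unique As)
    (sizes : ∀ {A} → A ∈ As → ∣ A ∣ ∈ K)
    (meets : ∀ {A B} → A ∈ As → B ∈ As → A ≢ B → ∣ A ∩ B ∣ ∈ L)
    (large : ∀ {k} → k ∈ K → length L < k ℕ.+ length K) where

    s r : ℕ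
    s = length L
    r = length K

    Node : Set
    Node = Subset n ⊎ Subset n

    -- inj₁ A carries ∏ (∣ A ∩ x ∣ - l) over l ∈ L with l < ∣ A ∣, and inj₂ I carries x_I ∏ (∣ x ∣ - k) over k ∈ K;
    -- the latter vanishes on the whole family.
    nodes : List Node
    nodes = map inj₁ As ++ map inj₂ (smaller n (suc s ∸ r))

    nodes-unique : Unique nodes
    nodes-unique = Unique.++⁺ (Unique.map⁺ inj₁-injective uniq) (Unique.map⁺ inj₂-injective (smaller-unique n (suc s ∸ r)))
      λ (x∈ˡ , x∈ʳ) → clash (∈-map⁻ inj₁ x∈ˡ) (∈-map⁻ inj₂ x∈ʳ)
      where
      clash : ∀ {x : Node} {Ss Ts : List (Subset n)} →
        (∃ λ S → S ∈ Ss × x ≡ inj₁ S) → ¬ (∃ λ T → T ∈ Ts × x ≡ inj₂ T)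
      clash (_ , _ , refl) (_ , _ , ())

    ∈-nodes-A : ∀ {A} → inj₁ A ∈ nodes → A ∈ As
    ∈-nodes-A x∈ with ∈-++⁻ (map inj₁ As) x∈
    ... | inj₁ x∈ˡ with _ , A∈ , refl ← ∈-map⁻ inj₁ x∈ˡ = A∈
    ... | inj₂ x∈ʳ with _ , _ , () ← ∈-map⁻ inj₂ x∈ʳ

    ∈-nodes-I : ∀ {I} → inj₂ I ∈ nodes → r ℕ.+ ∣ I ∣ ≤ s
    ∈-nodes-I x∈ with ∈-++⁻ (map inj₁ As) x∈
    ... | inj₁ x∈ˡ with _ , _ , () ← ∈-map⁻ inj₁ x∈ˡ
    ... | inj₂ x∈ʳ with I , I∈ , refl ← ∈-map⁻ inj₂ x∈ʳ =
      ℕ.≤-pred (ℕ.≰⇒> λ s<r+∣I∣ → ℕ.<⇒≱ (∈-smaller⁻ _ I∈) (ℕ.m≤n+o⇒m∸n≤o (suc s) r s<r+∣I∣))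

    point : Node → Subset n
    point (inj₁ A) = A
    point (inj₂ I) = I

    -- Since ∣ A ∣ ≤ n, the offset `suc n` puts every I above every member. The polynomial of a
    -- member is thus never tested at an I, where it need not vanish.
    rank : Node → ℕ
    rank (inj₁ A) = ∣ A ∣
    rank (inj₂ I) = suc n ℕ.+ ∣ I ∣

    base ground : Node → Subset n
    base (inj₁ A) = ⊥
    base (inj₂ I) = I
    ground (inj₁ A) = A
    ground (inj₂ I) = ⊤

    roots : Node → List ℕ
    roots (inj₁ A) = filter (ℕ._<? ∣ A ∣) L
    roots (inj₂ I) = K

    f : Node → Subset n → ℤ
    f x p = monomial (base x) p * levels (ground x) (roots x) p

    degree : ∀ {x} → x ∈ nodes → length (roots x) ℕ.+ ∣ base x ∣ ≤ s
    degree {inj₁ A} _ = begin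
      length (filter (ℕ._<? ∣ A ∣) L) ℕ.+ ∣ ⊥ {n} ∣ ≡⟨ cong (length (filter (ℕ._<? ∣ A ∣) L) ℕ.+_) (∣⊥∣≡0 n) ⟩
      length (filter (ℕ._<? ∣ A ∣) L) ℕ.+ 0       ≡⟨ ℕ.+-identityʳ _ ⟩
      length (filter (ℕ._<? ∣ A ∣) L)           ≤⟨ length-filter _ L ⟩
      s                                         ∎
      where open ℕ.≤-Reasoning
    degree {inj₂ I} x∈ = ∈-nodes-I x∈

    -- At A each factor is ∣ A ∣ - l with l < ∣ A ∣; the filter in `roots` removes a level equal to
    -- ∣ A ∣. At I the monomial is 1, and `large` gives ∣ I ∣ ≤ s - r < k for each root k.
    f-self : ∀ {x} → x ∈ nodes → f x (point x) ≢ 0ℤ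
    f-self {inj₁ A} x∈ eq with ℤ.i*j≡0⇒i≡0∨j≡0 (monomial (⊥ {n}) A) eq
    ... | inj₁ eq₁ with () ← trans (sym (monomial-⊆ {S = ⊥ {n}} {A} ⊥⊆)) eq₁
    ... | inj₂ eq₂ = levels-≢0 A (filter (ℕ._<? ∣ A ∣) L)
      (λ l∈ ∣A∩A∣≡l → ℕ.<⇒≢ (proj₂ (∈-filter⁻ (ℕ._<? ∣ A ∣) {xs = L} l∈)) (trans (sym ∣A∩A∣≡l) (cong ∣_∣ (∩-idem A)))) eq₂
    f-self {inj₂ I} x∈ eq with ℤ.i*j≡0⇒i≡0∨j≡0 (monomial I I) eq
    ... | inj₁ eq₁ with () ← trans (sym (monomial-⊆ {S = I} {I} (λ z → z))) eq₁
    ... | inj₂ eq₂ = levels-≢0 ⊤ K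
      (λ k∈ ∣⊤∩I∣≡k → ℕ.<-irrefl refl (ℕ.<-≤-trans (large k∈)
        (subst (λ k → k ℕ.+ r ≤ s) (trans (cong ∣_∣ (sym (∩-identityˡ I))) ∣⊤∩I∣≡k)
          (subst (_≤ s) (ℕ.+-comm r ∣ I ∣) (∈-nodes-I x∈))))) eq₂

    -- Two members: from ∣ B ∣ ≤ ∣ A ∣ and A ≢ B follows ∣ A ∩ B ∣ < ∣ A ∣, so this level passes the
    -- filter and is a root. Member against J: excluded by rank. I against a member: ∣ B ∣ ∈ K is a
    -- root. I against J: I ⊆ J would force I ≡ J, so x_I vanishes at J.
    f-other : ∀ {x y} → x ∈ nodes → y ∈ nodes → x ≢ y → rank y ≤ rank x → f x (point y) ≡ 0ℤ
    f-other {inj₁ A} {inj₁ B} x∈ y∈ x≢y ∣B∣≤∣A∣ = trans (cong (monomial ⊥ B *_) (levels-∈ A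
        (∈-filter⁺ (ℕ._<? ∣ A ∣) (meets (∈-nodes-A x∈) (∈-nodes-A y∈) (x≢y ∘ cong inj₁)) (ℕ.≰⇒> A≰A∩B))))
        (ℤ.*-zeroʳ (monomial ⊥ B))
      where
      A≰A∩B : ¬ (∣ A ∣ ≤ ∣ A ∩ B ∣)
      A≰A∩B ∣A∣≤ = x≢y (cong inj₁ (trans (sym (⊆∧∣∣≥⇒≡ (p∩q⊆p A B) ∣A∣≤)) 
        (⊆∧∣∣≥⇒≡ (p∩q⊆q A B) (ℕ.≤-trans ∣B∣≤∣A∣ ∣A∣≤))))
    f-other {inj₁ A} {inj₂ J} _ _ _ rank≤ =
      contradiction (ℕ.≤-trans (s≤s (ℕ.m≤m+n n ∣ J ∣)) (ℕ.≤-trans rank≤ (∣p∣≤n A))) (ℕ.<-irrefl refl)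
    f-other {inj₂ I} {inj₁ B} _ y∈ _ _ = trans (cong (monomial I B *_) (levels-∈ ⊤
        (subst (λ C → ∣ C ∣ ∈ K) (sym (∩-identityˡ B)) (sizes (∈-nodes-A y∈)))))
        (ℤ.*-zeroʳ (monomial I B))
    f-other {inj₂ I} {inj₂ J} _ _ x≢y rank≤ = cong (_* levels ⊤ K J)
      (monomial-⊈ λ I⊆J → x≢y (cong inj₂ (⊆∧∣∣≥⇒≡ I⊆J (ℕ.+-cancelˡ-≤ (suc n) ∣ J ∣ ∣ I ∣ rank≤))))

    length-nodes≤ : length nodes ≤ length (smaller n (suc s))
    length-nodes≤ = ℕ.≮⇒≥ absurd
      where
      absurd : ¬ (length (smaller n (suc s)) < length nodes)
      absurd D<N with dependent D<N (λ a d → monomial (lookup (smaller n (suc s)) d) (point (lookup nodes a)))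
      ... | c , c≢0 , eqs with maximiser (λ a → ¬? (c a ℤ.≟ 0ℤ)) (rank ∘ lookup nodes) c≢0
      -- One sum is evaluated twice: it vanishes because `f x` has degree at most s, and it
      -- collapses to its term at a.
      ...   | a , ca≢0 , maximal with ℤ.i*j≡0⇒i≡0∨j≡0 (c a) (trans (sym (sum-single a off)) vanish)
        where
        x = lookup nodes a
        x∈ = ∈-lookup {xs = nodes} a
        kills : ∀ S → ∣ S ∣ ≤ s → sum (λ b → c b * monomial S (point (lookup nodes b))) ≡ 0ℤ
        kills S ∣S∣≤s = subst (λ T → sum (λ b → c b * monomial T (point (lookup nodes b))) ≡ 0ℤ)
          (sym (lookup-index S∈)) (eqs (index S∈))
          where S∈ = ∈-smaller⁺ {t = suc s} {S} (s≤s ∣S∣≤s)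
        vanish : sum (λ b → c b * f x (point (lookup nodes b))) ≡ 0ℤ
        vanish = annihilates c (point ∘ lookup nodes) kills (ground x) (roots x) (base x) (degree x∈)
        -- Off the support the weight is 0; on it, maximality supplies the rank inequality for
        -- `f-other`.
        off : ∀ b → b ≢ a → c b * f x (point (lookup nodes b)) ≡ 0ℤ
        off b b≢a with c b ℤ.≟ 0ℤ
        ... | yes cb≡0 = cong (_* f x (point (lookup nodes b))) cb≡0
        ... | no cb≢0 = trans (cong (c b *_)
          (f-other x∈ (∈-lookup b) (λ eq → b≢a (sym (lookup-injective nodes-unique eq))) (maximal b cb≢0))) (ℤ.*-zeroʳ (c b))
      ...     | inj₁ ca≡0 = ca≢0 ca≡0
      ...     | inj₂ fx≡0 = f-self (∈-lookup {xs = nodes} a) fx≡0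

    bound : length As ≤ boundSum n s r
    bound = ℕ.+-cancelʳ-≤ (length (smaller n (suc s ∸ r))) (length As) (boundSum n s r) (begin
      length As ℕ.+ length (smaller n (suc s ∸ r))
        ≡⟨ cong₂ ℕ._+_ (length-map inj₁ As) (length-map inj₂ (smaller n (suc s ∸ r))) ⟨
      length (map inj₁ As) ℕ.+ length (map inj₂ (smaller n (suc s ∸ r)))
        ≡⟨ length-++ (map inj₁ As) ⟨
      length nodes
        ≤⟨ length-nodes≤ ⟩
      length (smaller n (suc s))
        ≡⟨ boundSum+length-smaller n s r ⟨
      boundSum n s r ℕ.+ length (smaller n (suc s ∸ r)) ∎)
      where open ℕ.≤-Reasoning

open import Data.Nat using (_+_; _*_)
open import Data.Nat.Tactic.RingSolver using (solve-∀)

-- Deleting a common subset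

-- The ground set itself shrinks to ∣ ∁ T ∣ points, so that the resulting bound is in n ∸ ∣ T ∣.
delete : ∀ {n} (T : Subset n) → Subset n → Subset ∣ ∁ T ∣
delete []            []      = []
delete (inside ∷ T)  (_ ∷ A) = delete T A
delete (outside ∷ T) (b ∷ A) = b ∷ delete T A

∣delete∣ : ∀ {n} {T A : Subset n} → T ⊆ A → ∣ delete T A ∣ ≡ ∣ A ∣ ∸ ∣ T ∣
∣delete∣ {T = T} {A} T⊆A = trans (sym (ℕ.m+n∸m≡n ∣ T ∣ _)) (cong (_∸ ∣ T ∣) (sizes T A T⊆A))
  where
  sizes : ∀ {n} (T A : Subset n) → T ⊆ A → ∣ T ∣ + ∣ delete T A ∣ ≡ ∣ A ∣
  sizes []            []            _   = refl
  sizes (inside ∷ T)  (inside ∷ A)  T⊆A = cong suc (sizes T A (drop-∷-⊆ T⊆A))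
  sizes (inside ∷ T)  (outside ∷ A) T⊆A with () ← T⊆A Vec.here
  sizes (outside ∷ T) (outside ∷ A) T⊆A = sizes T A (drop-∷-⊆ T⊆A)
  sizes (outside ∷ T) (inside ∷ A)  T⊆A =
    trans (ℕ.+-suc ∣ T ∣ ∣ delete T A ∣) (cong suc (sizes T A (drop-∷-⊆ T⊆A)))

delete-∩ : ∀ {n} (T A B : Subset n) → delete T A ∩ delete T B ≡ delete T (A ∩ B)
delete-∩ []            []      []      = refl
delete-∩ (inside ∷ T)  (_ ∷ A) (_ ∷ B) = delete-∩ T A B
delete-∩ (outside ∷ T) (_ ∷ A) (_ ∷ B) = cong (_ ∷_) (delete-∩ T A B)

delete-injective : ∀ {n} {T A B : Subset n} → T ⊆ A → T ⊆ B → delete T A ≡ delete T B → A ≡ B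
delete-injective {T = []} {[]} {[]} _ _ _ = refl
delete-injective {T = inside ∷ T} {inside ∷ A} {inside ∷ B} T⊆A T⊆B eq =
  cong (inside ∷_) (delete-injective (drop-∷-⊆ T⊆A) (drop-∷-⊆ T⊆B) eq)
delete-injective {T = inside ∷ T} {outside ∷ A} T⊆A _ _ with () ← T⊆A Vec.here
delete-injective {T = inside ∷ T} {inside ∷ A} {outside ∷ B} _ T⊆B _ with () ← T⊆B Vec.here
delete-injective {T = outside ∷ T} {a ∷ A} {b ∷ B} T⊆A T⊆B eq =
  cong₂ _∷_ (∷-injectiveˡ eq)
    (delete-injective (drop-∷-⊆ T⊆A) (drop-∷-⊆ T⊆B) (∷-injectiveʳ eq))

-- Injectivity is asked only on the list because `delete T` is injective only on sets containing T.
map-unique : ∀ {A B : Set} {f : A → B} {xs} →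
  (∀ {x y} → x ∈ xs → y ∈ xs → f x ≡ f y → x ≡ y) → Unique xs → Unique (map f xs)
map-unique f-inj []             = []
map-unique {f = f} {x ∷ xs} f-inj (x∉xs ∷ uniq) =
  All.map⁺ (All.tabulate λ y∈ fx≡fy →
    All.lookup x∉xs y∈ (f-inj (here refl) (there y∈) fx≡fy))
  ∷ map-unique (λ x∈ y∈ → f-inj (there x∈) (there y∈)) uniq

-- Deleting T lowers every size and every intersection size by ∣ T ∣, so `L` and `K` are shifted by
-- ∣ T ∣ with their lengths kept.
star-bound : ∀ {n} (T : Subset n) (L K : List ℕ) (As : List (Subset n)) → Unique As →
  (∀ {A} → A ∈ As → T ⊆ A) →
  (∀ {A} → A ∈ As → ∣ A ∣ ∈ K) →
  (∀ {A B} → A ∈ As → B ∈ As → A ≢ B → ∣ A ∩ B ∣ ∈ L) →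
  (∀ {k} → k ∈ K → length L + ∣ T ∣ < k + length K) →
  length As ≤ boundSum (n ∸ ∣ T ∣) (length L) (length K)
star-bound {n} T L K As uniq T⊆ sizes meets large =
  subst₂ _≤_ (length-map (delete T) As) reindex
    (AlonBabaiSuzuki.bound (map (_∸ ∣ T ∣) L) (map (_∸ ∣ T ∣) K) (map (delete T) As)
      (map-unique (λ A∈ B∈ → delete-injective (T⊆ A∈) (T⊆ B∈)) uniq) sizes′ meets′ large′)
  where
  reindex : boundSum ∣ ∁ T ∣ (length (map (_∸ ∣ T ∣) L)) (length (map (_∸ ∣ T ∣) K))
          ≡ boundSum (n ∸ ∣ T ∣) (length L) (length K)
  reindex rewrite length-map (_∸ ∣ T ∣) L | length-map (_∸ ∣ T ∣) K | ∣∁p∣≡n∸∣p∣ T = refl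
  sizes′ : ∀ {A} → A ∈ map (delete T) As → ∣ A ∣ ∈ map (_∸ ∣ T ∣) K
  sizes′ A∈ with A , A∈′ , refl ← ∈-map⁻ (delete T) A∈ =
    subst (_∈ map (_∸ ∣ T ∣) K) (sym (∣delete∣ (T⊆ A∈′))) (∈-map⁺ (_∸ ∣ T ∣) (sizes A∈′))
  meets′ : ∀ {A B} → A ∈ map (delete T) As → B ∈ map (delete T) As → A ≢ B → ∣ A ∩ B ∣ ∈ map (_∸ ∣ T ∣) L
  meets′ A∈ B∈ A≢B with A , A∈′ , refl ← ∈-map⁻ (delete T) A∈ | B , B∈′ , refl ← ∈-map⁻ (delete T) B∈ =
    subst (_∈ map (_∸ ∣ T ∣) L)
      (sym (trans (cong ∣_∣ (delete-∩ T A B)) (∣delete∣ λ x∈T → x∈p∩q⁺ (T⊆ A∈′ x∈T , T⊆ B∈′ x∈T))))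
      (∈-map⁺ (_∸ ∣ T ∣) (meets A∈′ B∈′ (A≢B ∘ cong (delete T))))
  large′ : ∀ {k} → k ∈ map (_∸ ∣ T ∣) K → length (map (_∸ ∣ T ∣) L) < k + length (map (_∸ ∣ T ∣) K)
  large′ k∈ with k , k∈′ , refl ← ∈-map⁻ (_∸ ∣ T ∣) k∈
    rewrite length-map (_∸ ∣ T ∣) L | length-map (_∸ ∣ T ∣) K = ℕ.+-cancelʳ-< ∣ T ∣ (length L) _ (begin-strict
      length L + ∣ T ∣                   <⟨ large k∈′ ⟩
      -- Only an inequality: some k may lie below ∣ T ∣, where the truncated difference is 0.
      k + length K                       ≤⟨ ℕ.+-monoˡ-≤ (length K) (ℕ.m≤n+m∸n k ∣ T ∣) ⟩
      ∣ T ∣ + (k ∸ ∣ T ∣) + length K     ≡⟨ ℕ.+-assoc ∣ T ∣ (k ∸ ∣ T ∣) (length K) ⟩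
      ∣ T ∣ + ((k ∸ ∣ T ∣) + length K)   ≡⟨ ℕ.+-comm ∣ T ∣ _ ⟩
      (k ∸ ∣ T ∣) + length K + ∣ T ∣     ∎)
    where open ℕ.≤-Reasoning

-- Families without a common t-subset

∣∪∣+∣∩∣ : ∀ {n} (A B : Subset n) → ∣ A ∪ B ∣ + ∣ A ∩ B ∣ ≡ ∣ A ∣ + ∣ B ∣
∣∪∣+∣∩∣ []            []            = refl
∣∪∣+∣∩∣ (outside ∷ A) (outside ∷ B) = ∣∪∣+∣∩∣ A B
∣∪∣+∣∩∣ (inside ∷ A)  (outside ∷ B) = cong suc (∣∪∣+∣∩∣ A B)
∣∪∣+∣∩∣ (outside ∷ A) (inside ∷ B)  = trans (cong suc (∣∪∣+∣∩∣ A B)) (sym (ℕ.+-suc ∣ A ∣ ∣ B ∣))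
∣∪∣+∣∩∣ (inside ∷ A)  (inside ∷ B)  = cong suc (trans (ℕ.+-suc ∣ A ∪ B ∣ ∣ A ∩ B ∣)
  (trans (cong suc (∣∪∣+∣∩∣ A B)) (sym (ℕ.+-suc ∣ A ∣ ∣ B ∣))))

∩-monoʳ-⊆ : ∀ {n} (A : Subset n) {B C} → B ⊆ C → A ∩ B ⊆ A ∩ C
∩-monoʳ-⊆ A {B} B⊆C x∈ with x∈A , x∈B ← x∈p∩q⁻ A B x∈ = x∈p∩q⁺ (x∈A , B⊆C x∈B)

subset-of-size : ∀ {n} (S : Subset n) i → i ≤ ∣ S ∣ → ∃ λ T → T ⊆ S × ∣ T ∣ ≡ i
subset-of-size {n} S zero    _ = ⊥ , ⊥⊆ , ∣⊥∣≡0 n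
subset-of-size (outside ∷ S) (suc i) i≤ with T , T⊆S , ∣T∣≡ ← subset-of-size S (suc i) i≤ =
  outside ∷ T , out⊆ T⊆S , ∣T∣≡
subset-of-size (inside ∷ S) (suc i) (s≤s i≤) with T , T⊆S , ∣T∣≡ ← subset-of-size S i i≤ =
  inside ∷ T , in⊆in T⊆S , cong suc ∣T∣≡

-- The difference of the two sides is (k - 1)(k - 2).
3k≤k²+2 : ∀ k → k + k + k ≤ k * k + 2
3k≤k²+2 0 = z≤n
3k≤k²+2 1 = ℕ.≤-refl
3k≤k²+2 2 = ℕ.≤-refl
3k≤k²+2 k@(suc (suc (suc j))) = subst (k + k + k ≤_) (sym (expand j)) (ℕ.m≤m+n (k + k + k) (2 + 3 * j + j * j))
  where
  expand : ∀ j → (3 + j) * (3 + j) + 2 ≡ (3 + j) + (3 + j) + (3 + j) + (2 + 3 * j + j * j)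
  expand = solve-∀

-- Let T = A a ∩ A b have size t and T ⊈ A c, and put M = A a ∪ A b ∪ A c. If A j met M in at most t points, its
-- intersections with A a, A b and A c would all equal A j ∩ M, which would then be T, forcing T ⊆ A c. Moreover
-- ∣ M ∣ ≤ 3k - 2t with t ≥ 1, and 3k - 2 ≤ k².
module _ {m n} (A : Fin m → Subset n) {t k : ℕ} (a : Fin m)
  (meets : ∀ i j → t ≤ ∣ A i ∩ A j ∣) (sizes : ∀ i → ∣ A i ∣ ≤ k) where

  kernel-or-cover : (∃ λ T → ∣ T ∣ ≡ t × (∀ j → T ⊆ A j)) ⊎
                    (∃ λ M → ∣ M ∣ ≤ k * k × (∀ j → t < ∣ A j ∩ M ∣))
  kernel-or-cover with any? (λ b → ∣ A a ∩ A b ∣ ≟ t)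
  -- Every member, `A a` included, meets `A a` in more than t points, so `A a` itself serves as M.
  ... | no  none     = inj₂ (A a , ℕ.≤-trans (sizes a) (k≤k*k k) , λ j →
    ℕ.≤∧≢⇒< (meets j a) λ t≡ → none (j , trans (cong ∣_∣ (∩-comm (A a) (A j))) (sym t≡)))
    where
    k≤k*k : ∀ k → k ≤ k * k
    k≤k*k zero    = z≤n
    k≤k*k (suc k) = ℕ.m≤m+n (suc k) (k * suc k)
  ... | yes (b , ∣T∣≡t) with any? (λ c → ¬? (A a ∩ A b ⊆? A c))
  ...   | no  none       = inj₁ (A a ∩ A b , ∣T∣≡t ,
    λ j → decidable-stable (A a ∩ A b ⊆? A j) λ T⊈ → none (j , T⊈))
  ...   | yes (c , T⊈Ac) = inj₂ (M , ∣M∣≤k² , λ j → ℕ.≰⇒> (λ ∣A∩M∣≤t → T⊈Ac (T⊆Ac j ∣A∩M∣≤t)))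
    where
    T U M : Subset n
    T = A a ∩ A b
    U = A a ∪ A b
    M = U ∪ A c
    -- An empty T would be contained in `A c`.
    0<t : 0 < t
    0<t = ℕ.n≢0⇒n>0 λ t≡0 → T⊈Ac (⊆-trans (⊆-reflexive (sym (⊆∧∣∣≥⇒≡ ⊥⊆
      (ℕ.≤-trans (ℕ.≤-reflexive (trans ∣T∣≡t t≡0)) z≤n)))) ⊥⊆)
    ∣M∣≤k² : ∣ M ∣ ≤ k * k
    -- Inclusion-exclusion twice: one t is absorbed by ∣ U ∩ A c ∣, which is at least ∣ A c ∩ A a ∣,
    -- and the other is ∣ T ∣.
    ∣M∣≤k² = ℕ.+-cancelʳ-≤ 2 ∣ M ∣ (k * k) (begin
      ∣ M ∣ + 2                              ≤⟨ ℕ.+-monoʳ-≤ ∣ M ∣ (ℕ.+-mono-≤ 0<t 0<t) ⟩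
      ∣ M ∣ + (t + t)                        ≤⟨ ℕ.+-monoʳ-≤ ∣ M ∣ (ℕ.+-monoˡ-≤ t (ℕ.≤-trans (meets c a)
                                                  (p⊆q⇒∣p∣≤∣q∣ (⊆-trans (∩-monoʳ-⊆ (A c) (p⊆p∪q (A b)))
                                                    (⊆-reflexive (∩-comm (A c) U)))))) ⟩
      ∣ M ∣ + (∣ U ∩ A c ∣ + t)              ≡⟨ ℕ.+-assoc ∣ M ∣ ∣ U ∩ A c ∣ t ⟨
      ∣ M ∣ + ∣ U ∩ A c ∣ + t                ≡⟨ cong (_+ t) (∣∪∣+∣∩∣ U (A c)) ⟩
      ∣ U ∣ + ∣ A c ∣ + t                    ≡⟨ swap ∣ U ∣ ∣ A c ∣ t ⟩
      ∣ U ∣ + t + ∣ A c ∣                    ≡⟨ cong (λ x → ∣ U ∣ + x + ∣ A c ∣) ∣T∣≡t ⟨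
      ∣ U ∣ + ∣ T ∣ + ∣ A c ∣                ≡⟨ cong (_+ ∣ A c ∣) (∣∪∣+∣∩∣ (A a) (A b)) ⟩
      ∣ A a ∣ + ∣ A b ∣ + ∣ A c ∣            ≤⟨ ℕ.+-mono-≤ (ℕ.+-mono-≤ (sizes a) (sizes b)) (sizes c) ⟩
      k + k + k                              ≤⟨ 3k≤k²+2 k ⟩
      k * k + 2                              ∎)
      where
      open ℕ.≤-Reasoning
      swap : ∀ x y z → x + y + z ≡ x + z + y
      swap = solve-∀
    module _ (j : Fin m) (∣A∩M∣≤t : ∣ A j ∩ M ∣ ≤ t) where
      trace : ∀ i → A i ⊆ M → A j ∩ M ≡ A j ∩ A i
      trace i Ai⊆M = sym (⊆∧∣∣≥⇒≡ (∩-monoʳ-⊆ (A j) Ai⊆M) (ℕ.≤-trans ∣A∩M∣≤t (meets j i)))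
      A∩M⊆ : ∀ i → A i ⊆ M → A j ∩ M ⊆ A i
      A∩M⊆ i Ai⊆M x∈ = p∩q⊆q (A j) (A i) (subst (_ Subset.∈_) (trace i Ai⊆M) x∈)
      Aa⊆M : A a ⊆ M
      Aa⊆M = p⊆p∪q (A c) ∘ p⊆p∪q (A b)
      A∩M≡T : A j ∩ M ≡ T
      A∩M≡T = ⊆∧∣∣≥⇒≡ (λ x∈ → x∈p∩q⁺ (A∩M⊆ a Aa⊆M x∈ , A∩M⊆ b (p⊆p∪q (A c) ∘ q⊆p∪q (A a) (A b)) x∈))
        (begin
          ∣ T ∣           ≡⟨ ∣T∣≡t ⟩
          t               ≤⟨ meets j a ⟩
          ∣ A j ∩ A a ∣   ≤⟨ p⊆q⇒∣p∣≤∣q∣ (∩-monoʳ-⊆ (A j) Aa⊆M) ⟩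
          ∣ A j ∩ M ∣     ∎)
        where open ℕ.≤-Reasoning
      T⊆Ac : T ⊆ A c
      T⊆Ac x∈T = A∩M⊆ c (q⊆p∪q U (A c)) (subst (_ Subset.∈_) (sym A∩M≡T) x∈T)

module _ {X : Set} {P : X → Set} (P? : ∀ x → Dec (P x)) where
  length-filter-split : ∀ xs → length xs ≡ length (filter P? xs) + length (filter (¬? ∘ P?) xs)
  length-filter-split []       = refl
  length-filter-split (x ∷ xs) with P? x
  ... | yes _ = cong suc (length-filter-split xs)
  ... | no  _ = trans (cong suc (length-filter-split xs)) (sym (ℕ.+-suc (length (filter P? xs)) _))

-- Each x is counted at the first y related to it; what remains is covered by the later ones.
union-bound : ∀ {X Y : Set} {R : Y → X → Set} (R? : ∀ y x → Dec (R y x)) (ys : List Y) (xs : List X) {β} →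
  (∀ {x} → x ∈ xs → Any (λ y → R y x) ys) →
  (∀ {y} → y ∈ ys → length (filter (R? y) xs) ≤ β) →
  length xs ≤ length ys * β
union-bound R? []       []       covered _ = z≤n
union-bound R? []       (x ∷ xs) covered _ with () ← covered (here refl)
union-bound {R = R} R? (y ∷ ys) xs {β} covered small = begin
  length xs                                                         ≡⟨ length-filter-split (R? y) xs ⟩
  length (filter (R? y) xs) + length (filter (¬? ∘ R? y) xs)        ≤⟨ ℕ.+-mono-≤ (small (here refl)) rest ⟩
  β + length ys * β                                                 ∎
  where
  open ℕ.≤-Reasoning
  remaining = filter (¬? ∘ R? y) xs
  covered′ : ∀ {x} → x ∈ remaining → Any (λ z → R z x) ys
  covered′ x∈ with x∈xs , ¬Ryx ← ∈-filter⁻ (¬? ∘ R? y) {xs = xs} x∈ with covered x∈xs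
  ... | here Ryx   = contradiction Ryx ¬Ryx
  ... | there later = later
  rest : length remaining ≤ length ys * β
  rest = union-bound R? ys remaining covered′ λ {z} z∈ →
    ℕ.≤-trans (length-mono-≤ (filter⁺ (R? z) (R? z) (λ { refl Rzx → Rzx }) (filter-⊆ (¬? ∘ R? y) xs))) (small (there z∈))

-- Binomial estimates

nCk>0 : ∀ {n k} → k ≤ n → 0 < n C k
nCk>0 {n}     {zero}  _         = ℕ.≤-reflexive (sym (nC0≡1 n))
nCk>0 {suc n} {suc k} (s≤s k≤n) = ℕ.<-≤-trans (nCk>0 k≤n)
  (ℕ.≤-trans (ℕ.m≤m+n (n C k) (n C suc k)) (ℕ.≤-reflexive (nCk+nC[k+1]≡[n+1]C[k+1] n k)))

nCk≤[1+n]Ck : ∀ n k → n C k ≤ suc n C k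
nCk≤[1+n]Ck n zero    = ℕ.≤-reflexive (trans (nC0≡1 n) (sym (nC0≡1 (suc n))))
nCk≤[1+n]Ck n (suc k) = ℕ.≤-trans (ℕ.m≤n+m (n C suc k) (n C k)) (ℕ.≤-reflexive (nCk+nC[k+1]≡[n+1]C[k+1] n k))

C-monoˡ-≤ : ∀ {m n} k → m ≤ n → m C k ≤ n C k
C-monoˡ-≤ k m≤n = go (ℕ.≤⇒≤′ m≤n)
  where
  go : ∀ {m n} → m ℕ.≤′ n → m C k ≤ n C k
  go ℕ.≤′-refl       = ℕ.≤-refl
  go (ℕ.≤′-step m≤n) = ℕ.≤-trans (go m≤n) (nCk≤[1+n]Ck _ k)

absorption : ∀ n k → suc k * (suc n C suc k) ≡ suc n * (n C k)
absorption zero    zero    = refl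
absorption zero    (suc k) = trans (cong (suc (suc k) *_) (k>n⇒nCk≡0 {1} {suc (suc k)} (s≤s (s≤s z≤n))))
  (trans (ℕ.*-zeroʳ (suc (suc k))) (sym (trans (ℕ.*-identityˡ (0 C suc k)) (k>n⇒nCk≡0 {0} {suc k} (s≤s z≤n)))))
absorption (suc n) zero    = trans (ℕ.*-identityˡ _) (trans (nC1≡n (suc (suc n)))
  (sym (trans (cong (suc (suc n) *_) (nC0≡1 (suc n))) (ℕ.*-identityʳ _))))
absorption (suc n) (suc k) = begin
  suc (suc k) * (suc (suc n) C suc (suc k))
    ≡⟨ cong (suc (suc k) *_) (nCk+nC[k+1]≡[n+1]C[k+1] (suc n) (suc k)) ⟨
  suc (suc k) * (suc n C suc k + suc n C suc (suc k))
    ≡⟨ spread (suc k) (suc n C suc k) (suc n C suc (suc k)) ⟩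
  suc n C suc k + (suc k * (suc n C suc k) + suc (suc k) * (suc n C suc (suc k)))
    ≡⟨ cong (suc n C suc k +_) (cong₂ _+_ (absorption n k) (absorption n (suc k))) ⟩
  suc n C suc k + (suc n * (n C k) + suc n * (n C suc k))
    ≡⟨ cong (suc n C suc k +_) (ℕ.*-distribˡ-+ (suc n) (n C k) (n C suc k)) ⟨
  suc n C suc k + suc n * (n C k + n C suc k)
    ≡⟨ cong (λ x → suc n C suc k + suc n * x) (nCk+nC[k+1]≡[n+1]C[k+1] n k) ⟩
  suc (suc n) * (suc n C suc k) ∎
  where
  open ≡-Reasoning
  spread : ∀ k x y → suc k * (x + y) ≡ x + (k * x + suc k * y)
  spread = solve-∀

module _ {n : ℕ} (q i : ℕ) where
  private
    rescale : suc i * (q * (n C i)) ≡ q * suc i * (n C i)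
    rescale = trans (sym (ℕ.*-assoc (suc i) q (n C i))) (cong (_* (n C i)) (ℕ.*-comm (suc i) q))

  -- By `absorption`, passing from n C i to suc n C suc i multiplies by (n + 1)/(i + 1), here at
  -- least q.
  q*nCk≤ : q * suc i ≤ suc n → q * (n C i) ≤ suc n C suc i
  q*nCk≤ q*[1+i]≤1+n = ℕ.*-cancelˡ-≤ (suc i) (begin
    suc i * (q * (n C i))       ≡⟨ rescale ⟩
    q * suc i * (n C i)         ≤⟨ ℕ.*-monoˡ-≤ (n C i) q*[1+i]≤1+n ⟩
    suc n * (n C i)             ≡⟨ absorption n i ⟨
    suc i * (suc n C suc i)     ∎)
    where open ℕ.≤-Reasoning

  -- The condition i ≤ n makes n C i positive; otherwise both sides would be 0.
  q*nCk< : q * suc i < suc n → i ≤ n → q * (n C i) < suc n C suc i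
  q*nCk< q*[1+i]<1+n i≤n = ℕ.*-cancelˡ-< (suc i) _ _ (begin-strict
    suc i * (q * (n C i))       ≡⟨ rescale ⟩
    q * suc i * (n C i)         <⟨ ℕ.*-monoˡ-< (n C i) {{ℕ.>-nonZero (nCk>0 i≤n)}} q*[1+i]<1+n ⟩
    suc n * (n C i)             ≡⟨ absorption n i ⟨
    suc i * (suc n C suc i)     ∎)
    where open ℕ.≤-Reasoning

-- Terms with a smaller lower index grow by a larger factor, so the condition for the leading index
-- s suffices for all j.
q*binomSub≤ : ∀ {n s} q j → q * suc s ≤ suc n → q * binomSub n s j ≤ binomSub (suc n) (suc s) j
q*binomSub≤ {n} {s} q j q*s≤n with j ≤? s | j ≤? suc s
... | no _    | _       = ℕ.≤-trans (ℕ.≤-reflexive (ℕ.*-zeroʳ q)) z≤n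
... | yes j≤s | no j≰1+s = contradiction (ℕ.m≤n⇒m≤1+n j≤s) j≰1+s
... | yes j≤s | yes _   rewrite ℕ.+-∸-assoc 1 j≤s =
  q*nCk≤ q (s ∸ j) (ℕ.≤-trans (ℕ.*-monoʳ-≤ q (s≤s (ℕ.m∸n≤m s j))) q*s≤n)

q*boundSum≤ : ∀ {n s} q r → q * suc s ≤ suc n → q * boundSum n s r ≤ boundSum (suc n) (suc s) r
q*boundSum≤ q zero    _ = ℕ.≤-reflexive (ℕ.*-zeroʳ q)
q*boundSum≤ {n} {s} q (suc r) q*s≤n = ℕ.≤-trans (ℕ.≤-reflexive (ℕ.*-distribˡ-+ q (boundSum n s r) (binomSub n s r)))
  (ℕ.+-mono-≤ (q*boundSum≤ q r q*s≤n) (q*binomSub≤ q r q*s≤n))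

-- Strictness comes from the leading term j = 0, present because the number of terms is `suc r`.
q*boundSum< : ∀ {n s} q r → q * suc s < suc n → s ≤ n → q * boundSum n s (suc r) < boundSum (suc n) (suc s) (suc r)
q*boundSum< {n} {s} q zero    q*s<n s≤n = q*nCk< q s q*s<n s≤n
q*boundSum< {n} {s} q (suc r) q*s<n s≤n =
  ℕ.≤-<-trans (ℕ.≤-reflexive (ℕ.*-distribˡ-+ q (boundSum n s (suc r)) (binomSub n s (suc r))))
    (ℕ.+-mono-<-≤ (q*boundSum< q r q*s<n s≤n) (q*binomSub≤ q (suc r) (ℕ.<⇒≤ q*s<n)))

-- Here the lower bound on n is spent: trading s and n for their predecessors gains a factor q, the
-- number of stars. The strict part needs s ≤ n - 1, which follows from q ≥ 1; q = 0 would leave no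
-- members.
absorb-factor : ∀ {m n s} q {r} → 0 < m → 0 < r → m ≤ q * boundSum (pred n) s r → q * suc s ≤ n →
  m ≤ boundSum n (suc s) r × (q * suc s < n → m < boundSum n (suc s) r)
absorb-factor zero 0<m _ m≤0 _ = contradiction (ℕ.<-≤-trans 0<m m≤0) λ ()
absorb-factor {n = suc n} {s} (suc q) {suc r} _ _ m≤ q*s≤n =
  ℕ.≤-trans m≤ (q*boundSum≤ (suc q) (suc r) q*s≤n) ,
  λ q*s<n → ℕ.≤-<-trans m≤ (q*boundSum< (suc q) r q*s<n (ℕ.≤-pred (ℕ.≤-trans (ℕ.m≤m+n (suc s) (q * suc s)) q*s≤n)))

-- With this many terms the sum counts all sets of size at most s + 1, among them the empty set and
-- the n singletons.
n<boundSum : ∀ n {s r} → suc s < r → n < boundSum n (suc s) r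
n<boundSum n {s} {r} 1+s<r = begin
  suc n                                                               ≤⟨ few s ⟩
  length (smaller n (suc (suc s)))                                    ≡⟨ boundSum+length-smaller n (suc s) r ⟨
  boundSum n (suc s) r + length (smaller n (suc (suc s) ∸ r))         ≡⟨ cong (λ t → boundSum n (suc s) r + length (smaller n t))
                                                                           (ℕ.m≤n⇒m∸n≡0 1+s<r) ⟩
  boundSum n (suc s) r + 0                                            ≡⟨ ℕ.+-identityʳ _ ⟩
  boundSum n (suc s) r                                                ∎
  where
  open ℕ.≤-Reasoning
  few : ∀ s → suc n ≤ length (smaller n (suc (suc s)))
  few zero    = ℕ.≤-reflexive (sym (begin-equality
    length (smaller n 2)                     ≡⟨ length-smaller-suc n 1 ⟩
    n C 1 + length (smaller n 1)             ≡⟨ cong₂ _+_ (nC1≡n n) (length-smaller-suc n 0) ⟩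
    n + (n C 0 + 0)                          ≡⟨ cong (λ x → n + (x + 0)) (nC0≡1 n) ⟩
    n + 1                                    ≡⟨ ℕ.+-comm n 1 ⟩
    suc n                                    ∎))
  few (suc s) = ℕ.≤-trans (few s) (ℕ.≤-trans (ℕ.m≤n+m _ (n C suc (suc s)))
    (ℕ.≤-reflexive (sym (length-smaller-suc n (suc (suc s))))))

Fin⇒0< : ∀ {m} → Fin m → 0 < m
Fin⇒0< i = ℕ.≤-<-trans z≤n (toℕ<n i)

f≤maxF : ∀ {m} (f : Fin m → ℕ) i → f i ≤ maxF f
f≤maxF f zero    = ℕ.m≤m⊔n (f zero) _
f≤maxF f (suc i) = ℕ.≤-trans (f≤maxF (f ∘ suc) i) (ℕ.m≤n⊔m (f zero) _)

-- The main argument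

module Family {n s₀ r m} (l : Fin (suc s₀) → ℕ) (kv : Fin r → ℕ) (A : Fin m → Subset n)
  (l-increasing : ∀ i j → i Fin.< j → l i < l j)
  (large : ∀ i → suc s₀ + l zero < kv i + r)
  (A-injective : Injective _≡_ _≡_ A)
  (sizes : ∀ i → ∃ λ t → ∣ A i ∣ ≡ kv t)
  (meets : ∀ i j → i ≢ j → ∃ λ t → ∣ A i ∩ A j ∣ ≡ l t) where

  s l₁ k q : ℕ
  s = suc s₀
  l₁ = l zero
  k = maxF (λ j → ∣ A j ∣)
  q = (k * k) C (l₁ + 1)

  l₁≤l : ∀ t → l₁ ≤ l t
  l₁≤l zero    = ℕ.≤-refl
  l₁≤l (suc t) = ℕ.<⇒≤ (l-increasing zero (suc t) (s≤s z≤n))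

  star : Subset n → List (Subset n)
  star T = filter (T ⊆?_) (tabulate A)

  -- The equation lets `large` serve two cases: ∣ T ∣ = l₁ with all s levels, and ∣ T ∣ = l₁ + 1
  -- with the lowest level dropped.
  star≤ : ∀ T L → s + l₁ ≡ length L + ∣ T ∣ →
    (∀ i j → i ≢ j → T ⊆ A i → T ⊆ A j → ∣ A i ∩ A j ∣ ∈ L) →
    length (star T) ≤ boundSum (n ∸ ∣ T ∣) (length L) r
  star≤ T L s+l₁≡ meets-L = subst (λ r → length (star T) ≤ boundSum (n ∸ ∣ T ∣) (length L) r) (length-tabulate kv)
    (star-bound T L (tabulate kv) (star T) (Unique.filter⁺ (T ⊆?_) (Unique.tabulate⁺ A-injective))
      (λ A∈ → proj₂ (∈-star A∈)) sizes′ meets′ large′)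
    where
    ∈-star : ∀ {B} → B ∈ star T → B ∈ tabulate A × T ⊆ B
    ∈-star = ∈-filter⁻ (T ⊆?_)
    sizes′ : ∀ {B} → B ∈ star T → ∣ B ∣ ∈ tabulate kv
    sizes′ B∈ with B∈A , _ ← ∈-star B∈ with i , refl ← ∈-tabulate⁻ B∈A with t , eq ← sizes i =
      subst (_∈ tabulate kv) (sym eq) (∈-tabulate⁺ t)
    meets′ : ∀ {B D} → B ∈ star T → D ∈ star T → B ≢ D → ∣ B ∩ D ∣ ∈ L
    meets′ B∈ D∈ B≢D with B∈A , T⊆B ← ∈-star B∈ | D∈A , T⊆D ← ∈-star D∈
      with i , refl ← ∈-tabulate⁻ B∈A | j , refl ← ∈-tabulate⁻ D∈A =
      meets-L i j (B≢D ∘ cong A) T⊆B T⊆D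
    large′ : ∀ {k} → k ∈ tabulate kv → length L + ∣ T ∣ < k + length (tabulate kv)
    large′ k∈ with t , refl ← ∈-tabulate⁻ k∈ =
      subst₂ _<_ s+l₁≡ (cong (kv t +_) (sym (length-tabulate kv))) (large t)

  kernel⇒≤ : ∀ T → ∣ T ∣ ≡ l₁ → (∀ j → T ⊆ A j) → m ≤ boundSum (n ∸ l₁) s r
  kernel⇒≤ T ∣T∣≡l₁ T⊆ = begin
    m                                               ≡⟨ length-tabulate A ⟨
    length (tabulate A)                             ≡⟨ cong length (filter-all (T ⊆?_) (All.tabulate⁺ T⊆)) ⟨
    length (star T)                                 ≤⟨ star≤ T (tabulate l) (cong₂ _+_ (sym (length-tabulate l)) (sym ∣T∣≡l₁))
                                                         (λ i j i≢j _ _ → meets-l i j i≢j) ⟩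
    boundSum (n ∸ ∣ T ∣) (length (tabulate l)) r    ≡⟨ cong₂ (λ t s → boundSum (n ∸ t) s r) ∣T∣≡l₁ (length-tabulate l) ⟩
    boundSum (n ∸ l₁) s r                           ∎
    where
    open ℕ.≤-Reasoning
    meets-l : ∀ i j → i ≢ j → ∣ A i ∩ A j ∣ ∈ tabulate l
    meets-l i j i≢j with t , eq ← meets i j i≢j = subst (_∈ tabulate l) (sym eq) (∈-tabulate⁺ {f = l} t)

  larger-star≤ : ∀ T → ∣ T ∣ ≡ suc l₁ → length (star T) ≤ boundSum (n ∸ suc l₁) s₀ r
  larger-star≤ T ∣T∣≡ = subst₂ (λ t s → length (star T) ≤ boundSum (n ∸ t) s r) ∣T∣≡ (length-tabulate l′)
    (star≤ T (tabulate l′) (trans (sym (ℕ.+-suc s₀ l₁)) (cong₂ _+_ (sym (length-tabulate l′)) (sym ∣T∣≡))) meets-l′)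
    where
    l′ : Fin s₀ → ℕ
    l′ = l ∘ suc
    meets-l′ : ∀ i j → i ≢ j → T ⊆ A i → T ⊆ A j → ∣ A i ∩ A j ∣ ∈ tabulate l′
    meets-l′ i j i≢j T⊆Ai T⊆Aj with meets i j i≢j
    ... | suc t , eq = subst (_∈ tabulate l′) (sym eq) (∈-tabulate⁺ t)
    -- Both members contain T, so they share more than l₁ points.
    ... | zero  , eq = contradiction
      (ℕ.≤-trans (ℕ.≤-reflexive (sym ∣T∣≡)) (ℕ.≤-trans (p⊆q⇒∣p∣≤∣q∣ λ x∈T → x∈p∩q⁺ (T⊆Ai x∈T , T⊆Aj x∈T)) (ℕ.≤-reflexive eq)))
      (ℕ.<-irrefl refl)

  -- Each A j ∩ M contains an (l₁ + 1)-set, so the stars over the (l₁ + 1)-subsets of M cover the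
  -- family.
  cover⇒≤ : ∀ M → ∣ M ∣ ≤ k * k → (∀ j → l₁ < ∣ A j ∩ M ∣) → m ≤ q * boundSum (n ∸ suc l₁) s₀ r
  cover⇒≤ M ∣M∣≤k² l₁<∣A∩M∣ = begin
    m                                                          ≡⟨ length-tabulate A ⟨
    length (tabulate A)                                        ≤⟨ union-bound _⊆?_ (choices M (suc l₁)) (tabulate A) covered
                                                                    (λ {T} T∈ → larger-star≤ T (∈-choices⁻ M (suc l₁) T∈)) ⟩
    length (choices M (suc l₁)) * boundSum (n ∸ suc l₁) s₀ r   ≡⟨ cong (_* boundSum (n ∸ suc l₁) s₀ r) (length-choices M (suc l₁)) ⟩
    (∣ M ∣ C suc l₁) * boundSum (n ∸ suc l₁) s₀ r              ≤⟨ ℕ.*-monoˡ-≤ (boundSum (n ∸ suc l₁) s₀ r) (C-monoˡ-≤ (suc l₁) ∣M∣≤k²) ⟩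
    ((k * k) C suc l₁) * boundSum (n ∸ suc l₁) s₀ r            ≡⟨ cong (λ t → ((k * k) C t) * boundSum (n ∸ suc l₁) s₀ r) (ℕ.+-comm 1 l₁) ⟩
    q * boundSum (n ∸ suc l₁) s₀ r                             ∎
    where
    open ℕ.≤-Reasoning
    covered : ∀ {B} → B ∈ tabulate A → Any (_⊆ B) (choices M (suc l₁))
    covered B∈ with j , refl ← ∈-tabulate⁻ B∈
      with T , T⊆A∩M , ∣T∣≡ ← subset-of-size (A j ∩ M) (suc l₁) (l₁<∣A∩M∣ j) =
      lose (subst (λ t → T ∈ choices M t) ∣T∣≡ (∈-choices⁺ {S = T} (⊆-trans T⊆A∩M (p∩q⊆q (A j) M))))
        (⊆-trans {i = T} T⊆A∩M (p∩q⊆p (A j) M))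

  Kernel Bounds : Set
  Kernel = ∃ λ T → ∣ T ∣ ≡ l₁ × (∀ j → T ⊆ A j)
  Bounds = m ≤ boundSum (n ∸ l₁) s r × (q * s + l₁ < n → m < boundSum (n ∸ l₁) s r)

  cover⇒bounds : Fin m → q * s + l₁ ≤ n → ∀ M → ∣ M ∣ ≤ k * k → (∀ j → l₁ < ∣ A j ∩ M ∣) → Bounds
  cover⇒bounds a q*s+l₁≤n M ∣M∣≤k² l₁<∣A∩M∣ =
    proj₁ bounds , λ q*s+l₁<n → proj₂ bounds (ℕ.m+n≤o⇒m≤o∸n (suc (q * s)) q*s+l₁<n)
    where
    bounds : m ≤ boundSum (n ∸ l₁) s r × (q * s < n ∸ l₁ → m < boundSum (n ∸ l₁) s r)
    bounds = absorb-factor q (Fin⇒0< a) (Fin⇒0< (proj₁ (sizes a)))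
      (subst (λ n → m ≤ q * boundSum n s₀ r) (sym (ℕ.pred[m∸n]≡m∸[1+n] n l₁)) (cover⇒≤ M ∣M∣≤k² l₁<∣A∩M∣))
      (ℕ.m+n≤o⇒m≤o∸n (q * s) q*s+l₁≤n)

  -- A member smaller than l₁ is the only one, and its existence forces r > s.
  small-member⇒bounds : ∀ i → ∣ A i ∣ < l₁ → Bounds
  -- Since n ∸ l₁ may be 0, the weak bound uses 1 ≤ suc (n ∸ l₁); under the strict hypothesis 1 ≤ n
  -- ∸ l₁.
  small-member⇒bounds i ∣Ai∣<l₁ = ℕ.≤-trans m≤1 (ℕ.≤-trans (s≤s z≤n) n-l₁<) ,
    λ q*s+l₁<n → ℕ.≤-<-trans (ℕ.≤-trans m≤1 (ℕ.m<n⇒0<n∸m (ℕ.≤-<-trans (ℕ.m≤n+m l₁ (q * s)) q*s+l₁<n))) n-l₁<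
    where
    only : ∀ j → j ≡ i
    only j with j Fin.≟ i
    ... | yes j≡i = j≡i
    ... | no  j≢i with t , eq ← meets i j (j≢i ∘ sym) = contradiction
      (ℕ.<-≤-trans ∣Ai∣<l₁ (ℕ.≤-trans (l₁≤l t) (ℕ.≤-trans (ℕ.≤-reflexive (sym eq)) (∣p∩q∣≤∣p∣ (A i) (A j)))))
      (ℕ.<-irrefl refl)
    m≤1 : m ≤ 1
    m≤1 = injective⇒≤ {f = λ _ → zero} λ {x} {y} _ → trans (only x) (sym (only y))
    s<r : s < r
    s<r with t , eq ← sizes i = ℕ.+-cancelʳ-< l₁ s r (ℕ.<-trans (large t)
      (ℕ.<-≤-trans (ℕ.+-monoˡ-< r (subst (_< l₁) eq ∣Ai∣<l₁)) (ℕ.≤-reflexive (ℕ.+-comm l₁ r))))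
    n-l₁< : n ∸ l₁ < boundSum (n ∸ l₁) s r
    n-l₁< = n<boundSum (n ∸ l₁) s<r

  -- `kernel-or-cover` also asks for the diagonal i = j, where the claim is ∣ A i ∣ ≥ l₁; hence
  -- small members are treated apart.
  meets≥l₁ : ¬ (∃ λ i → ∣ A i ∣ < l₁) → ∀ i j → l₁ ≤ ∣ A i ∩ A j ∣
  meets≥l₁ none-small i j with i Fin.≟ j
  ... | no  i≢j  with t , eq ← meets i j i≢j = ℕ.≤-trans (l₁≤l t) (ℕ.≤-reflexive (sym eq))
  ... | yes refl = ℕ.≤-trans (ℕ.≮⇒≥ λ small → none-small (i , small)) (ℕ.≤-reflexive (cong ∣_∣ (sym (∩-idem (A i)))))

  kernel-or-bounds : Fin m → q * s + l₁ ≤ n → Kernel ⊎ Bounds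
  kernel-or-bounds a q*s+l₁≤n = case any? (λ i → ∣ A i ∣ <? l₁) of λ where
    (yes (i , ∣Ai∣<l₁)) → inj₂ (small-member⇒bounds i ∣Ai∣<l₁)
    (no none-small)     → map₂ (λ (M , ∣M∣≤k² , l₁<∣A∩M∣) → cover⇒bounds a q*s+l₁≤n M ∣M∣≤k² l₁<∣A∩M∣)
      (kernel-or-cover A a (meets≥l₁ none-small) (f≤maxF (λ j → ∣ A j ∣)))

theorem1p7 : (n s₀ r m : ℕ)
    (l : Fin (suc s₀) → ℕ)
    (kv : Fin r → ℕ)
    (A : Fin m → Subset n) →
    (∀ i j → Data.Fin._<_ i j → l i < l j) →
    Injective _≡_ _≡_ kv →
    (∀ i → 0 < kv i) →
    (∀ i → suc s₀ + l zero < kv i + r) →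
    Injective _≡_ _≡_ A →
    (∀ i → ∃ λ t → ∣ A i ∣ ≡ kv t) →
    (∀ i j → i ≢ j → ∃ λ t → ∣ A i ∩ A j ∣ ≡ l t) →
    let s = suc s₀
        l₁ = l zero
        k = maxF (λ j → ∣ A j ∣)
        bound = ((k * k) C (l₁ + 1)) * s + l₁
    in bound ≤ n →
       (m ≤ boundSum (n ∸ l₁) s r)
       × (bound < n → m ≡ boundSum (n ∸ l₁) s r →
            Σ (Subset n) λ T → ∣ T ∣ ≡ l₁ × (∀ j → T ⊆ A j))
-- For an empty family any l₁-set is a kernel, and one exists because l₁ ≤ n.
theorem1p7 n s₀ r zero l kv A _ _ _ _ _ _ _ bound≤n = z≤n , λ _ _ → emptyKernel
  where
  emptyKernel : Σ (Subset n) λ T → ∣ T ∣ ≡ l zero × (∀ j → T ⊆ A j)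
  emptyKernel with T , _ , ∣T∣≡l₁ ← subset-of-size (⊤ {n}) (l zero)
    (ℕ.≤-trans (ℕ.m≤n+m (l zero) _) (ℕ.≤-trans bound≤n (ℕ.≤-reflexive (sym (∣⊤∣≡n n))))) = T , ∣T∣≡l₁ , λ ()
theorem1p7 n s₀ r (suc m) l kv A l-increasing _ _ large A-injective sizes meets bound≤n
  with Family.kernel-or-bounds l kv A l-increasing large A-injective sizes meets zero bound≤n
... | inj₁ (T , ∣T∣≡l₁ , T⊆) =
  Family.kernel⇒≤ l kv A l-increasing large A-injective sizes meets T ∣T∣≡l₁ T⊆ , λ _ _ → T , ∣T∣≡l₁ , λ j → T⊆ j
-- Here the inequality is strict once n exceeds the threshold, so equality cannot occur.
... | inj₂ (≤bound , <bound) = ≤bound , λ bound<n m≡ → contradiction m≡ (ℕ.<⇒≢ (<bound bound<n))
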